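{- Let $M$ be a finite, loopless matroid with non-empty ground set. Then $a(M)\leq d(M)\leq c^*(M)$.
   Context: The arboricity $a(M)$ of a loopless matroid $M$ is the minimum number of independent sets into which $E(M)$ can be partitioned. A loopless matroid $M$ is $k$-degenerate if every non-empty restriction of $M$ has a cocircuit of size at most $k$; the degeneracy $d(M)$ is the smallest integer $k$ such that $M$ is $k$-degenerate. $c^*(M)$ is the size of a largest cocircuit of $M$. -}

module Defs where

open import Data.Nat using (ℕ; zero; suc; _≤_; _<_; _≤?_; z≤n)
open import Data.Nat.Properties using (≤∧≢⇒<; ≮⇒≥; m<1+n⇒m≤n; anyUpTo?)
  renaming (_≟_ to _≟ℕ_)
open import Data.Nat.Induction using (<-wellFounded)
open import Data.Bool.Properties using () renaming (_≟_ to _≟ᵇ_)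
open import Data.Fin using (Fin)
open import Data.Fin.Subset
open import Data.Fin.Subset.Properties
open import Data.Fin.Subset.Induction using (⊂-wellFounded; ⊃-wellFounded)
open import Data.List using (List; []; _∷_; length; map; filter; allFin)
open import Data.List.Membership.Propositional using () renaming (_∈_ to _∈ᴸ_)
open import Data.List.Membership.Propositional.Properties using (∈-allFin; ∈-filter⁺)
open import Data.List.Relation.Unary.All as All using (All; []; _∷_)
import Data.List.Relation.Unary.All.Properties as All
open import Data.List.Relation.Unary.Any using (here; there)
open import Data.List.Relation.Unary.AllPairs as AllPairs using (AllPairs; []; _∷_)
import Data.List.Relation.Unary.AllPairs.Properties as AllPairs
import Data.List.Relation.Unary.Unique.Propositional.Properties as Unique
open import Data.Vec using () renaming (_∷_ to _∷ᵛ_; there to thereᵛ)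
open import Data.Vec.Properties using (≡-dec)
open import Data.Product using (∃; ∃-syntax; _×_; _,_; proj₁; proj₂)
open import Data.Sum using (inj₁; inj₂)
open import Function using (_∘_)
open import Induction.WellFounded using (Acc; acc)
open import Level using (0ℓ)
open import Relation.Binary.PropositionalEquality
  using (_≡_; _≢_; refl; sym; trans; subst)
open import Relation.Nullary using (¬_; Dec; yes; no; ¬?; contradiction)
open import Relation.Nullary.Decidable using (map′; _×-dec_; _→-dec_; decidable-stable)
open import Relation.Unary using (Pred; Decidable)

private
  variable
    n : ℕ

IsLeast : Pred ℕ 0ℓ → Pred ℕ 0ℓ
IsLeast P k = P k × (∀ j → P j → k ≤ j)

IsGreatest : Pred ℕ 0ℓ → Pred ℕ 0ℓ
IsGreatest P k = P k × (∀ j → P j → j ≤ k)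

-- A finite matroid whose elements are drawn from Fin n.  The ground set is a
-- subset E of Fin n, so that M and its restrictions live in the same type.
-- Independence of a set is decidable, as for any (classical) finite matroid.
record Matroid (n : ℕ) : Set₁ where
  field
    E       : Subset n
    Indep   : Pred (Subset n) 0ℓ
    indep?  : Decidable Indep
    indep⊆E : ∀ {I} → Indep I → I ⊆ E
    indep-⊥ : Indep ⊥
    indep-↓ : ∀ {I J} → J ⊆ I → Indep I → Indep J
    augment : ∀ {I J} → Indep I → Indep J → ∣ I ∣ < ∣ J ∣ →
              ∃[ x ] (x ∈ J × x ∉ I × Indep (I ∪ ⁅ x ⁆))

open Matroid public

restrict : (M : Matroid n) (X : Subset n) → X ⊆ E M → Matroid n
restrict M X X⊆E = record
  { E       = X
  ; Indep   = λ I → Indep M I × I ⊆ X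
  ; indep?  = λ I → indep? M I ×-dec (I ⊆? X)
  ; indep⊆E = proj₂
  ; indep-⊥ = indep-⊥ M , ⊆-min X
  ; indep-↓ = λ J⊆I (ind , I⊆X) → indep-↓ M J⊆I ind , I⊆X ∘ J⊆I
  ; augment = aug
  }
  where
  aug : ∀ {I J} → Indep M I × I ⊆ X → Indep M J × J ⊆ X → ∣ I ∣ < ∣ J ∣ →
        ∃[ x ] (x ∈ J × x ∉ I × (Indep M (I ∪ ⁅ x ⁆) × (I ∪ ⁅ x ⁆) ⊆ X))
  aug {I} (indI , I⊆X) (indJ , J⊆X) lt with augment M indI indJ lt
  ... | x , x∈J , x∉I , ind = x , x∈J , x∉I , ind , I∪x⊆X
    where
    I∪x⊆X : (I ∪ ⁅ x ⁆) ⊆ X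
    I∪x⊆X y∈ with x∈p∪q⁻ I ⁅ x ⁆ y∈
    ... | inj₁ y∈I = I⊆X y∈I
    ... | inj₂ y∈x = subst (_∈ X) (sym (x∈⁅y⁆⇒x≡y x y∈x)) (J⊆X x∈J)

Basis : Matroid n → Pred (Subset n) 0ℓ
Basis M B = Indep M B × (∀ I → Indep M I → B ⊆ I → I ⊆ B)

-- The independent sets of the dual matroid M*, whose bases are the
-- complements E ─ B of the bases B of M.
Coindep : Matroid n → Pred (Subset n) 0ℓ
Coindep M X = ∃[ B ] (Basis M B × X ⊆ (E M ─ B))

MinimalDependent : Subset n → Pred (Subset n) 0ℓ → Pred (Subset n) 0ℓ
MinimalDependent G Ind C = C ⊆ G × ¬ Ind C × (∀ D → D ⊂ C → Ind D)

Circuit : Matroid n → Pred (Subset n) 0ℓ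
Circuit M = MinimalDependent (E M) (Indep M)

-- The circuits of M*.
Cocircuit : Matroid n → Pred (Subset n) 0ℓ
Cocircuit M = MinimalDependent (E M) (Coindep M)

Loop : Matroid n → Pred (Fin n) 0ℓ
Loop M e = Circuit M ⁅ e ⁆

Loopless : Matroid n → Set
Loopless M = ∀ e → ¬ Loop M e

Disjoint : Subset n → Subset n → Set
Disjoint X Y = Empty (X ∩ Y)

-- The entries of the list are the blocks of a partition of the ground set
-- into independent sets; as usual, blocks of a partition are non-empty.
IndepPartition : Matroid n → Pred (List (Subset n)) 0ℓ
IndepPartition M Is =
  All (Indep M) Is × All Nonempty Is × AllPairs Disjoint Is × ⋃ Is ≡ E M

PartitionableInto : Matroid n → Pred ℕ 0ℓ
PartitionableInto M k = ∃[ Is ] (length Is ≡ k × IndepPartition M Is)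

Degenerate : Matroid n → Pred ℕ 0ℓ
Degenerate M k = ∀ X (X⊆E : X ⊆ E M) → Nonempty X →
  ∃[ C ] (Cocircuit (restrict M X X⊆E) C × ∣ C ∣ ≤ k)

CocircuitSize : Matroid n → Pred ℕ 0ℓ
CocircuitSize M k = ∃[ C ] (Cocircuit M C × ∣ C ∣ ≡ k)

------------------------------------------------------------------------
-- The three parameters are extrema of the predicates above; they are defined
-- at the end, from proofs that these extrema exist.

least : {P : Pred ℕ 0ℓ} → Decidable P → ∃ P → ∃ (IsLeast P)
least {P} P? (k , Pk) = go k (<-wellFounded k) Pk
  where
  go : ∀ k → Acc _<_ k → P k → ∃ (IsLeast P)
  go k (acc rec) Pk with anyUpTo? P? k
  ... | yes (j , j<k , Pj) = go j (rec j<k) Pj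
  ... | no  none           = k , Pk , λ j Pj → ≮⇒≥ (λ j<k → none (j , j<k , Pj))

greatest : {P : Pred ℕ 0ℓ} → Decidable P → (b : ℕ) → (∀ j → P j → j ≤ b) →
           ∃ P → ∃ (IsGreatest P)
greatest P? b bound inh with P? b
... | yes Pb = b , Pb , bound
greatest P? zero    bound (j , Pj) | no ¬Pb with bound j Pj
... | z≤n = contradiction Pj ¬Pb
greatest {P} P? (suc b) bound inh | no ¬Pb = greatest P? b bound′ inh
  where
  bound′ : ∀ j → P j → j ≤ b
  bound′ j Pj = m<1+n⇒m≤n (≤∧≢⇒< (bound j Pj) (λ { refl → ¬Pb Pj }))

allSubset? : {P : Pred (Subset n) 0ℓ} → Decidable P → Dec (∀ X → P X)
allSubset? P? with anySubset? (¬? ∘ P?)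
... | yes (X , ¬PX) = no (λ all → ¬PX (all X))
... | no  none      = yes (λ X → decidable-stable (P? X) (λ ¬PX → none (X , ¬PX)))

anyListOfLength? : {P : Pred (List (Subset n)) 0ℓ} → Decidable P →
                   ∀ k → Dec (∃[ Is ] (length Is ≡ k × P Is))
anyListOfLength? P? zero =
  map′ (λ P[] → [] , refl , P[]) (λ { ([] , refl , P[]) → P[] }) (P? [])
anyListOfLength? P? (suc k) = map′
  (λ { (I , Is , refl , p) → I ∷ Is , refl , p })
  (λ { (I ∷ Is , refl , p) → I , Is , refl , p })
  (anySubset? (λ I → anyListOfLength? (λ Is → P? (I ∷ Is)) k))

basis? : (M : Matroid n) → Decidable (Basis M)
basis? M B = indep? M B ×-dec
  allSubset? (λ I → indep? M I →-dec ((B ⊆? I) →-dec (I ⊆? B)))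

coindep? : (M : Matroid n) → Decidable (Coindep M)
coindep? M X = anySubset? (λ B → basis? M B ×-dec (X ⊆? (E M ─ B)))

cocircuit? : (M : Matroid n) → Decidable (Cocircuit M)
cocircuit? M C = (C ⊆? E M) ×-dec (¬? (coindep? M C) ×-dec
  allSubset? (λ D → (D ⊂? C) →-dec coindep? M D))

indepPartition? : (M : Matroid n) → Decidable (IndepPartition M)
indepPartition? M Is =
  All.all? (indep? M) Is ×-dec (All.all? nonempty? Is ×-dec
    (AllPairs.allPairs? (λ X Y → ¬? (nonempty? (X ∩ Y))) Is ×-dec
      ≡-dec _≟ᵇ_ (⋃ Is) (E M)))

partitionableInto? : (M : Matroid n) → Decidable (PartitionableInto M)
partitionableInto? M = anyListOfLength? (indepPartition? M)

degenerate? : (M : Matroid n) → Decidable (Degenerate M)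
degenerate? M k = allSubset? go
  where
  go : ∀ X → Dec ((X⊆E : X ⊆ E M) → Nonempty X →
                   ∃[ C ] (Cocircuit (restrict M X X⊆E) C × ∣ C ∣ ≤ k))
  go X with X ⊆? E M
  ... | no  X⊈E = yes (λ X⊆E → contradiction (λ {x} → X⊆E {x}) X⊈E)
  ... | yes X⊆E = map′ (λ f _ → f) (λ f → f X⊆E)
    (nonempty? X →-dec
      anySubset? (λ C → cocircuit? (restrict M X X⊆E) C ×-dec (∣ C ∣ ≤? k)))

cocircuitSize? : (M : Matroid n) → Decidable (CocircuitSize M)
cocircuitSize? M k = anySubset? (λ C → cocircuit? M C ×-dec (∣ C ∣ ≟ℕ k))

⊂⁅⁆⇒≡⊥ : ∀ {e} {D : Subset n} → D ⊂ ⁅ e ⁆ → D ≡ ⊥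
⊂⁅⁆⇒≡⊥ {e = e} {D} (D⊆e , x , x∈e , x∉D) = Empty-unique λ (y , y∈D) →
  x∉D (subst (_∈ D) (trans (x∈⁅y⁆⇒x≡y e (D⊆e y∈D)) (sym (x∈⁅y⁆⇒x≡y e x∈e))) y∈D)

singleton-indep : (M : Matroid n) → Loopless M → ∀ {e} → e ∈ E M → Indep M ⁅ e ⁆
singleton-indep M ll {e} e∈E = decidable-stable (indep? M ⁅ e ⁆) λ ¬ind →
  ll e ( (λ x∈e → subst (_∈ E M) (sym (x∈⁅y⁆⇒x≡y e x∈e)) e∈E)
       , ¬ind
       , λ D D⊂e → subst (Indep M) (sym (⊂⁅⁆⇒≡⊥ D⊂e)) (indep-⊥ M))

restrict-loopless : (M : Matroid n) → Loopless M →
                    ∀ X (X⊆E : X ⊆ E M) → Loopless (restrict M X X⊆E)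
restrict-loopless M ll X X⊆E e (e⊆X , dep , min) =
  ll e ((λ x∈e → X⊆E (e⊆X x∈e)) , (λ ind → dep (ind , e⊆X)) , λ D D⊂e → proj₁ (min D D⊂e))

extend-to-basis : (M : Matroid n) → ∀ I → Indep M I → ∃[ B ] (Basis M B × I ⊆ B)
extend-to-basis M I = go I (⊃-wellFounded I)
  where
  go : ∀ I → Acc _⊃_ I → Indep M I → ∃[ B ] (Basis M B × I ⊆ B)
  go I (acc rec) indI with anySubset? (λ J → indep? M J ×-dec (I ⊂? J))
  ... | yes (J , indJ , I⊂J) with go J (rec I⊂J) indJ
  ...   | B , basis , J⊆B = B , basis , λ x∈I → J⊆B (proj₁ I⊂J x∈I)
  go I (acc rec) indI | no none = I , (indI , maximal) , λ x∈I → x∈I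
    where
    maximal : ∀ J → Indep M J → I ⊆ J → J ⊆ I
    maximal J indJ I⊆J {x} x∈J = decidable-stable (x ∈? I) λ x∉I →
      none (J , indJ , I⊆J , x , x∈J , x∉I)

minimal-dependent : {G : Subset n} {P : Pred (Subset n) 0ℓ} → Decidable P →
                    ∀ C → C ⊆ G → ¬ P C → ∃ (MinimalDependent G P)
minimal-dependent {G = G} {P} P? C = go C (⊂-wellFounded C)
  where
  go : ∀ C → Acc _⊂_ C → C ⊆ G → ¬ P C → ∃ (MinimalDependent G P)
  go C (acc rec) C⊆G ¬PC with anySubset? (λ D → (D ⊂? C) ×-dec ¬? (P? D))
  ... | yes (D , D⊂C , ¬PD) = go D (rec D⊂C) (λ x∈D → C⊆G (proj₁ D⊂C x∈D)) ¬PD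
  ... | no  none = C , C⊆G , ¬PC , λ D D⊂C →
    decidable-stable (P? D) (λ ¬PD → none (D , D⊂C , ¬PD))

x∈p─q⇒x∉q : ∀ {x} (p q : Subset n) → x ∈ p ─ q → x ∉ q
x∈p─q⇒x∉q (_ ∷ᵛ p) (outside ∷ᵛ q) (thereᵛ x∈) (thereᵛ x∈q) = x∈p─q⇒x∉q p q x∈ x∈q
x∈p─q⇒x∉q (_ ∷ᵛ p) (inside  ∷ᵛ q) (thereᵛ x∈) (thereᵛ x∈q) = x∈p─q⇒x∉q p q x∈ x∈q

cocircuit-exists : (M : Matroid n) → Loopless M → Nonempty (E M) → ∃ (Cocircuit M)
cocircuit-exists M ll (e , e∈E) =
  minimal-dependent (coindep? M) (E M) (λ x∈E → x∈E) E-codependent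
  where
  E-codependent : ¬ Coindep M (E M)
  E-codependent (B , (indB , maximal) , E⊆E─B) =
    x∉B e∈E (maximal ⁅ e ⁆ (singleton-indep M ll e∈E)
          (λ x∈B → contradiction x∈B (x∉B (indep⊆E M indB x∈B))) (x∈⁅x⁆ e))
    where
    x∉B : ∀ {x} → x ∈ E M → x ∉ B
    x∉B x∈E = x∈p─q⇒x∉q (E M) B (E⊆E─B x∈E)

partition-exists : (M : Matroid n) → Loopless M → ∃ (PartitionableInto M)
partition-exists {n} M ll = length Is , Is , refl , indeps , nonempties , disjoint , ⋃≡E
  where
  es : List (Fin n)
  es = filter (_∈? E M) (allFin n)

  Is : List (Subset n)
  Is = map ⁅_⁆ es

  es⊆E : All (_∈ E M) es
  es⊆E = All.all-filter (_∈? E M) (allFin n)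

  indeps : All (Indep M) Is
  indeps = All.map⁺ (All.map (singleton-indep M ll) es⊆E)

  nonempties : All Nonempty Is
  nonempties = All.map⁺ (All.universal (λ e → e , x∈⁅x⁆ e) es)

  ≢⇒disjoint : ∀ {x y : Fin n} → x ≢ y → Disjoint ⁅ x ⁆ ⁅ y ⁆
  ≢⇒disjoint {x} {y} x≢y (z , z∈) with x∈p∩q⁻ ⁅ x ⁆ ⁅ y ⁆ z∈
  ... | z∈x , z∈y = x≢y (trans (sym (x∈⁅y⁆⇒x≡y x z∈x)) (x∈⁅y⁆⇒x≡y y z∈y))

  disjoint : AllPairs Disjoint Is
  disjoint = AllPairs.map⁺ (AllPairs.map ≢⇒disjoint
    (Unique.filter⁺ (_∈? E M) (Unique.allFin⁺ n)))

  ⋃⊆ : ∀ xs → All (_∈ E M) xs → ⋃ (map ⁅_⁆ xs) ⊆ E M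
  ⋃⊆ []       []             z∈ = contradiction z∈ ∉⊥
  ⋃⊆ (x ∷ xs) (x∈E ∷ xs⊆E) z∈ with x∈p∪q⁻ ⁅ x ⁆ (⋃ (map ⁅_⁆ xs)) z∈
  ... | inj₁ z∈x  = subst (_∈ E M) (sym (x∈⁅y⁆⇒x≡y x z∈x)) x∈E
  ... | inj₂ z∈xs = ⋃⊆ xs xs⊆E z∈xs

  ∈⋃ : ∀ {z} xs → z ∈ᴸ xs → z ∈ ⋃ (map ⁅_⁆ xs)
  ∈⋃ {z} (x ∷ xs) (here refl)  = x∈p∪q⁺ (inj₁ (x∈⁅x⁆ z))
  ∈⋃     (x ∷ xs) (there z∈xs) = x∈p∪q⁺ (inj₂ (∈⋃ xs z∈xs))

  ⋃≡E : ⋃ Is ≡ E M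
  ⋃≡E = ⊆-antisym (⋃⊆ es es⊆E)
    (λ {z} z∈E → ∈⋃ es (∈-filter⁺ (_∈? E M) (∈-allFin z) z∈E))

arboricity-exists : (M : Matroid n) → Loopless M → ∃ (IsLeast (PartitionableInto M))
arboricity-exists M ll = least (partitionableInto? M) (partition-exists M ll)

degeneracy-exists : (M : Matroid n) → Loopless M → ∃ (IsLeast (Degenerate M))
degeneracy-exists {n} M ll = least (degenerate? M) (n , λ X X⊆E ne →
  let C , cocircuit = cocircuit-exists (restrict M X X⊆E) (restrict-loopless M ll X X⊆E) ne
  in  C , cocircuit , ∣p∣≤n C)

c*-exists : (M : Matroid n) → Loopless M → Nonempty (E M) →
            ∃ (IsGreatest (CocircuitSize M))
c*-exists {n} M ll ne = greatest (cocircuitSize? M) n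
  (λ { _ (C , _ , refl) → ∣p∣≤n C })
  (let C , cocircuit = cocircuit-exists M ll ne in ∣ C ∣ , C , cocircuit , refl)

arboricity : (M : Matroid n) → Loopless M → ℕ
arboricity M ll = proj₁ (arboricity-exists M ll)

degeneracy : (M : Matroid n) → Loopless M → ℕ
degeneracy M ll = proj₁ (degeneracy-exists M ll)

c* : (M : Matroid n) → Loopless M → Nonempty (E M) → ℕ
c* M ll ne = proj₁ (c*-exists M ll ne)

{-# OPTIONS --safe #-}

-- Let C be a cocircuit of a matroid N.  Its complement is a hyperplane, so
-- every independent set disjoint from C stays independent when one element of
-- C is added.  If every restriction has a cocircuit of size at most k, peel off
-- such cocircuits one at a time and, going back, give the elements of each of
-- them distinct colours out of k: every colour class is independent, whence
-- a(M) ≤ d(M).  For d(M) ≤ c*(M), every cocircuit D of a restriction M | X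
-- extends to a cocircuit of M, because bases of M | X can be exchanged for one
-- another inside a basis of M.

module Submission where

open import Defs
open import Data.Nat using (ℕ; zero; suc; _+_; _≤_; _<_; z≤n; s≤s; z<s; s<s)
open import Data.Nat.Properties
  using (≤-trans; ≤-reflexive; <-≤-trans; ≮⇒≥; ≰⇒>; <-irrefl; +-suc; +-monoˡ-≤; +-monoʳ-≤;
         suc-injective; module ≤-Reasoning)
  renaming (_≟_ to _≟ℕ_)
open import Data.Fin using (Fin; zero; suc; _≟_)
open import Data.Fin.Subset
open import Data.Fin.Subset.Properties
open import Data.Fin.Subset.Induction using (⊂-wellFounded)
open import Data.List using (List; length; map; filter; upTo)
open import Data.List.Properties using (length-map; length-upTo; length-filter)
open import Data.List.Membership.Propositional using () renaming (_∈_ to _∈ᴸ_)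
open import Data.List.Membership.Propositional.Properties using (∈-filter⁺; ∈-map⁺; ∈-upTo⁺)
open import Data.List.Relation.Unary.All as All using (All; []; _∷_)
import Data.List.Relation.Unary.All.Properties as All
open import Data.List.Relation.Unary.Any using (here; there)
open import Data.List.Relation.Unary.AllPairs as AllPairs using (AllPairs)
import Data.List.Relation.Unary.AllPairs.Properties as AllPairs
import Data.List.Relation.Unary.Unique.Propositional.Properties as Unique
open import Data.Vec using (tabulate; []; _∷_; here; there)
open import Data.Vec.Properties using (lookup⇒[]=; []=⇒lookup; lookup∘tabulate)
open import Data.Product using (∃; ∃-syntax; _×_; _,_; proj₁; proj₂)
open import Data.Sum using (inj₁; inj₂)
open import Function using (_∘_; const)
open import Induction.WellFounded using (Acc; acc)
open import Level using (0ℓ)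
open import Relation.Binary.PropositionalEquality
  using (_≡_; _≢_; refl; sym; trans; cong; subst)
open import Relation.Nullary using (¬_; yes; no; does; contradiction)
open import Relation.Nullary.Decidable using (_×-dec_; decidable-stable; dec-true)
open import Relation.Unary using (Pred; Decidable)

private
  variable
    n k : ℕ

-- Finite subsets

∪-lub : {p q r : Subset n} → p ⊆ r → q ⊆ r → p ∪ q ⊆ r
∪-lub {p = p} {q} p⊆r q⊆r x∈ with x∈p∪q⁻ p q x∈
... | inj₁ x∈p = p⊆r x∈p
... | inj₂ x∈q = q⊆r x∈q

x∈p⇒⁅x⁆⊆p : ∀ {x} {p : Subset n} → x ∈ p → ⁅ x ⁆ ⊆ p
x∈p⇒⁅x⁆⊆p {x = x} {p} x∈p y∈ = subst (_∈ p) (sym (x∈⁅y⁆⇒x≡y x y∈)) x∈p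

∣p∪q∣≤∣p∣+∣q∣ : (p q : Subset n) → ∣ p ∪ q ∣ ≤ ∣ p ∣ + ∣ q ∣
∣p∪q∣≤∣p∣+∣q∣ []            []            = z≤n
∣p∪q∣≤∣p∣+∣q∣ (outside ∷ p) (outside ∷ q) = ∣p∪q∣≤∣p∣+∣q∣ p q
∣p∪q∣≤∣p∣+∣q∣ (outside ∷ p) (inside  ∷ q) =
  ≤-trans (s≤s (∣p∪q∣≤∣p∣+∣q∣ p q)) (≤-reflexive (sym (+-suc ∣ p ∣ ∣ q ∣)))
∣p∪q∣≤∣p∣+∣q∣ (inside  ∷ p) (s ∷ q)       =
  s≤s (≤-trans (∣p∪q∣≤∣p∣+∣q∣ p q) (+-monoʳ-≤ ∣ p ∣ (∣p∣≤∣x∷p∣ s q)))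

∣p∩q∣+∣p─q∣≡∣p∣ : (p q : Subset n) → ∣ p ∩ q ∣ + ∣ p ─ q ∣ ≡ ∣ p ∣
∣p∩q∣+∣p─q∣≡∣p∣ []            []            = refl
∣p∩q∣+∣p─q∣≡∣p∣ (outside ∷ p) (outside ∷ q) = ∣p∩q∣+∣p─q∣≡∣p∣ p q
∣p∩q∣+∣p─q∣≡∣p∣ (outside ∷ p) (inside  ∷ q) = ∣p∩q∣+∣p─q∣≡∣p∣ p q
∣p∩q∣+∣p─q∣≡∣p∣ (inside  ∷ p) (outside ∷ q) =
  trans (+-suc ∣ p ∩ q ∣ ∣ p ─ q ∣) (cong suc (∣p∩q∣+∣p─q∣≡∣p∣ p q))
∣p∩q∣+∣p─q∣≡∣p∣ (inside  ∷ p) (inside  ∷ q) = cong suc (∣p∩q∣+∣p─q∣≡∣p∣ p q)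

⟦_⟧ : {P : Pred (Fin n) 0ℓ} → Decidable P → Subset n
⟦ P? ⟧ = tabulate (does ∘ P?)

∈⟦⟧⁺ : ∀ {P : Pred (Fin n) 0ℓ} (P? : Decidable P) {x} → P x → x ∈ ⟦ P? ⟧
∈⟦⟧⁺ P? {x} Px = lookup⇒[]= x ⟦ P? ⟧
  (trans (lookup∘tabulate (does ∘ P?) x) (dec-true (P? x) Px))

∈⟦⟧⁻ : ∀ {P : Pred (Fin n) 0ℓ} (P? : Decidable P) {x} → x ∈ ⟦ P? ⟧ → P x
∈⟦⟧⁻ P? {x} x∈ with P? x | trans (sym (lookup∘tabulate (does ∘ P?) x)) ([]=⇒lookup x∈)
... | yes Px | _  = Px
... | no  _  | ()

⊆⋃ : ∀ {X : Subset n} {Xs} → X ∈ᴸ Xs → X ⊆ ⋃ Xs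
⊆⋃ (here refl)  x∈X = x∈p∪q⁺ (inj₁ x∈X)
⊆⋃ (there X∈Xs) x∈X = x∈p∪q⁺ (inj₂ (⊆⋃ X∈Xs x∈X))

⋃⊆ : ∀ {Y : Subset n} {Xs} → All (_⊆ Y) Xs → ⋃ Xs ⊆ Y
⋃⊆ []            x∈ = contradiction x∈ ∉⊥
⋃⊆ (X⊆Y ∷ Xs⊆Y) x∈ = ∪-lub X⊆Y (⋃⊆ Xs⊆Y) x∈

-- The number of elements of `p` below `x`. It numbers the elements of `p` from 0 and thus supplies
-- distinct colours for a cocircuit.
position : Subset n → Fin n → ℕ
position p             zero    = 0
position (inside  ∷ p) (suc x) = suc (position p x)
position (outside ∷ p) (suc x) = position p x

position<∣p∣ : ∀ {p : Subset n} {x} → x ∈ p → position p x < ∣ p ∣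
position<∣p∣                   here        = z<s
position<∣p∣ {p = inside  ∷ p} (there x∈p) = s<s (position<∣p∣ x∈p)
position<∣p∣ {p = outside ∷ p} (there x∈p) = position<∣p∣ x∈p

position-injective : ∀ {p : Subset n} {x y} → x ∈ p → y ∈ p →
                     position p x ≡ position p y → x ≡ y
position-injective                   here        here        _  = refl
position-injective                   here        (there _)   ()
position-injective                   (there _)   here        ()
position-injective {p = inside  ∷ p} (there x∈p) (there y∈p) eq =
  cong suc (position-injective x∈p y∈p (suc-injective eq))
position-injective {p = outside ∷ p} (there x∈p) (there y∈p) eq =
  cong suc (position-injective x∈p y∈p eq)

-- Bases

basis-exists : (M : Matroid n) → ∃ (Basis M)
basis-exists M with extend-to-basis M ⊥ (indep-⊥ M)
... | B , basis , _ = B , basis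

indep⇒∣∣≤basis : (M : Matroid n) → ∀ {B I} → Basis M B → Indep M I → ∣ I ∣ ≤ ∣ B ∣
indep⇒∣∣≤basis M {B} {I} (indB , maxB) indI = ≮⇒≥ λ B<I →
  let x , _ , x∉B , indB∪x = augment M indB indI B<I
  in  x∉B (maxB (B ∪ ⁅ x ⁆) indB∪x (p⊆p∪q ⁅ x ⁆) (q⊆p∪q B ⁅ x ⁆ (x∈⁅x⁆ x)))

-- A strictly larger independent superset of `I` would outgrow the basis `B`.
large-indep⇒basis : (M : Matroid n) → ∀ {B I} → Basis M B → Indep M I → ∣ B ∣ ≤ ∣ I ∣ →
                    Basis M I
large-indep⇒basis M {B} {I} basisB indI B≤I = indI , λ J indJ I⊆J {x} x∈J →
  decidable-stable (x ∈? I) λ x∉I → <-irrefl refl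
    (<-≤-trans (p⊂q⇒∣p∣<∣q∣ {p = I} {J} (I⊆J , x , x∈J , x∉I))
               (≤-trans (indep⇒∣∣≤basis M basisB indJ) B≤I))

restricted-basis-closed :
  (M : Matroid n) → ∀ {X} (X⊆E : X ⊆ E M) {B x} → Basis (restrict M X X⊆E) B →
  x ∈ X → Indep M (B ∪ ⁅ x ⁆) → x ∈ B
restricted-basis-closed M X⊆E {B} {x} ((_ , B⊆X) , maxB) x∈X indB∪x =
  maxB (B ∪ ⁅ x ⁆) (indB∪x , ∪-lub B⊆X (x∈p⇒⁅x⁆⊆p x∈X))
    (p⊆p∪q ⁅ x ⁆) (q⊆p∪q B ⁅ x ⁆ (x∈⁅x⁆ x))

-- The augmenting element cannot lie in `X`, because a basis of the restriction is already maximal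
-- there.
augment-restricted-basis :
  (M : Matroid n) → ∀ {X} (X⊆E : X ⊆ E M) {B I} → Basis (restrict M X X⊆E) B →
  Indep M I → ∣ B ∣ < ∣ I ∣ → ∃[ x ] (x ∈ I × x ∉ X × Indep M (B ∪ ⁅ x ⁆))
augment-restricted-basis M X⊆E basisB@((indB , _) , _) indI B<I =
  let x , x∈I , x∉B , indB∪x = augment M indB indI B<I
  in  x , x∈I , (λ x∈X → x∉B (restricted-basis-closed M X⊆E basisB x∈X indB∪x)) , indB∪x

-- Extend `A` to a basis `J` of the restriction to `U`. Augmentation shows that `J` is as large as
-- `B`, while the hypothesis on `A` gives `∣ U ∣ ≤ ∣ B ∣`; hence `J` is all of `U`.
exchange-restricted-basis :
  (M : Matroid n) → ∀ {X} (X⊆E : X ⊆ E M) {A B} → Basis (restrict M X X⊆E) A →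
  Basis M B → ∣ A ∣ ≤ ∣ B ∩ X ∣ → Basis M (A ∪ (B ─ X))
exchange-restricted-basis M {X} X⊆E {A} {B} basisA@((indA , A⊆X) , _) basisB@(indB , _) A≤B∩X
  = large-indep⇒basis M basisB (indep-↓ M U⊆J indJ) (≤-trans B≤J (p⊆q⇒∣p∣≤∣q∣ J⊆U))
  where
  U : Subset _
  U = A ∪ (B ─ X)

  U⊆E : U ⊆ E M
  U⊆E = ∪-lub (indep⊆E M indA) (λ x∈ → indep⊆E M indB (p─q⊆p B X x∈))

  extension : ∃[ J ] (Basis (restrict M U U⊆E) J × A ⊆ J)
  extension = extend-to-basis (restrict M U U⊆E) A (indA , p⊆p∪q (B ─ X))

  J : Subset _
  J = proj₁ extension

  basisJ : Basis (restrict M U U⊆E) J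
  basisJ = proj₁ (proj₂ extension)

  A⊆J : A ⊆ J
  A⊆J = proj₂ (proj₂ extension)

  indJ : Indep M J
  indJ = proj₁ (proj₁ basisJ)

  J⊆U : J ⊆ U
  J⊆U = proj₂ (proj₁ basisJ)

  B≤J : ∣ B ∣ ≤ ∣ J ∣
  -- An element of `B` outside `U` must lie in `X`. If it could be added to `J`, it could be added
  -- to `A`, so it would already belong to `A`.
  B≤J = ≮⇒≥ λ J<B →
    let x , x∈B , x∉U , indJ∪x = augment-restricted-basis M U⊆E basisJ indB J<B
        x∈X = decidable-stable (x ∈? X) λ x∉X →
                x∉U (q⊆p∪q A (B ─ X) (x∈p∧x∉q⇒x∈p─q x∈B x∉X))
        A∪x⊆J∪x : A ∪ ⁅ x ⁆ ⊆ J ∪ ⁅ x ⁆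
        A∪x⊆J∪x = ∪-lub (λ y∈A → p⊆p∪q ⁅ x ⁆ (A⊆J y∈A)) (q⊆p∪q J ⁅ x ⁆)
    in  x∉U (p⊆p∪q (B ─ X) (restricted-basis-closed M X⊆E basisA x∈X (indep-↓ M A∪x⊆J∪x indJ∪x)))

  U≤B : ∣ U ∣ ≤ ∣ B ∣
  U≤B = begin
    ∣ U ∣                   ≤⟨ ∣p∪q∣≤∣p∣+∣q∣ A (B ─ X) ⟩
    ∣ A ∣ + ∣ B ─ X ∣       ≤⟨ +-monoˡ-≤ ∣ B ─ X ∣ A≤B∩X ⟩
    ∣ B ∩ X ∣ + ∣ B ─ X ∣   ≡⟨ ∣p∩q∣+∣p─q∣≡∣p∣ B X ⟩
    ∣ B ∣                   ∎
    where open ≤-Reasoning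

  U⊆J : U ⊆ J
  U⊆J {y} y∈U = decidable-stable (y ∈? J) λ y∉J → <-irrefl refl
    (<-≤-trans (p⊂q⇒∣p∣<∣q∣ {p = J} {U} (J⊆U , y , y∈U , y∉J)) (≤-trans U≤B B≤J))

-- Cocircuits

cocircuit-nonempty : (M : Matroid n) → ∀ {C} → Cocircuit M C → Nonempty C
cocircuit-nonempty M {C} (_ , ¬coindC , _) = decidable-stable (nonempty? C) λ empty →
  let B , basis = basis-exists M
  in  ¬coindC (B , basis , λ {x} x∈C → contradiction (x , x∈C) empty)

-- A basis avoiding C - c meets C only in c, and it is larger than every
-- independent set disjoint from C.
cocircuit-augment : (M : Matroid n) → ∀ {C I c} → Cocircuit M C → Indep M I →
                    Disjoint I C → c ∈ C → Indep M (I ∪ ⁅ c ⁆)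
cocircuit-augment M {C} {I} {c} (C⊆E , ¬coindC , minC) indI I∩C≡∅ c∈C = indI∪c
  where
  Y : Subset _
  Y = E M ─ C

  Y⊆E : Y ⊆ E M
  Y⊆E = p─q⊆p (E M) C

  I⊆Y : I ⊆ Y
  I⊆Y {x} x∈I = x∈p∧x∉q⇒x∈p─q (indep⊆E M indI x∈I) λ x∈C → I∩C≡∅ (x , x∈p∩q⁺ (x∈I , x∈C))

  indI∪c : Indep M (I ∪ ⁅ c ⁆)
  indI∪c with minC (C - c) (x∈p⇒p-x⊂p c∈C) | extend-to-basis (restrict M Y Y⊆E) I (indI , I⊆Y)
  ... | B , basisB@(indB , _) , C-c⊆E─B | J , basisJ@((indJ , J⊆Y) , _) , I⊆J =
    indep-↓ M
      (∪-lub (λ y∈I → p⊆p∪q ⁅ x ⁆ (I⊆J y∈I))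
             (subst (λ y → ⁅ y ⁆ ⊆ J ∪ ⁅ x ⁆) x≡c (q⊆p∪q J ⁅ x ⁆)))
      indJ∪x
    where
    -- Otherwise `J` would itself be a basis of `M` avoiding `C`.
    J<B : ∣ J ∣ < ∣ B ∣
    J<B = ≰⇒> λ B≤J →
      ¬coindC (J , large-indep⇒basis M basisB indJ B≤J , λ x∈C →
        x∈p∧x∉q⇒x∈p─q (C⊆E x∈C) λ x∈J → x∈p─q⇒x∉q (E M) C (J⊆Y x∈J) x∈C)

    augmented : ∃[ x ] (x ∈ B × x ∉ Y × Indep M (J ∪ ⁅ x ⁆))
    augmented = augment-restricted-basis M Y⊆E basisJ indB J<B

    x : Fin _
    x = proj₁ augmented

    x∈B : x ∈ B
    x∈B = proj₁ (proj₂ augmented)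

    indJ∪x : Indep M (J ∪ ⁅ x ⁆)
    indJ∪x = proj₂ (proj₂ (proj₂ augmented))

    x∈C : x ∈ C
    x∈C = decidable-stable (x ∈? C) λ x∉C →
      proj₁ (proj₂ (proj₂ augmented)) (x∈p∧x∉q⇒x∈p─q (indep⊆E M indB x∈B) x∉C)

    x≡c : x ≡ c
    x≡c = decidable-stable (x ≟ c) λ x≢c →
      x∈p─q⇒x∉q (E M) B (C-c⊆E─B (x∈p∧x≢y⇒x∈p-y x∈C x≢c)) x∈B

-- The cocircuit is found inside D ∪ ((E ─ X) ─ B), where the basis B of M
-- contains a basis of M | X; removing B forces C to contain D.
extend-restricted-cocircuit :
  (M : Matroid n) → ∀ {X} (X⊆E : X ⊆ E M) {D} → Cocircuit (restrict M X X⊆E) D →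
  ∃[ C ] (Cocircuit M C × D ⊆ C)
extend-restricted-cocircuit M {X} X⊆E {D} (D⊆X , ¬coindD , minD)
  with basis-exists (restrict M X X⊆E)
... | B₀ , basisB₀@((indB₀ , B₀⊆X) , _) with extend-to-basis M B₀ indB₀
... | B , basisB , B₀⊆B = C , (C⊆E , ¬coindC , proj₂ (proj₂ minimal)) , D⊆C
  where
  G : Subset _
  G = D ∪ ((E M ─ X) ─ B)

  G⊆E : G ⊆ E M
  G⊆E = ∪-lub (λ x∈D → X⊆E (D⊆X x∈D)) (λ x∈ → p─q⊆p (E M) X (p─q⊆p (E M ─ X) B x∈))

  -- The size condition holds because `B ∩ X` contains `B₀`, which is as large as any independent
  -- subset of `X`.
  exchange : ∀ {A} → Basis (restrict M X X⊆E) A → Basis M (A ∪ (B ─ X))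
  exchange basisA@(indA , _) = exchange-restricted-basis M X⊆E basisA basisB
    (≤-trans (indep⇒∣∣≤basis (restrict M X X⊆E) basisB₀ indA)
             (p⊆q⇒∣p∣≤∣q∣ λ x∈B₀ → x∈p∩q⁺ (B₀⊆B x∈B₀ , B₀⊆X x∈B₀)))

  -- Outside `X`, a basis `B′` avoiding `G` lies in `B`. So `B′` is contained in the independent set
  -- `A ∪ (B ─ X)` and equals it by maximality; then `A` avoids `D`, which is impossible.
  ¬coindG : ¬ Coindep M G
  ¬coindG (B′ , (indB′ , maxB′) , G⊆E─B′)
    with extend-to-basis (restrict M X X⊆E) (B′ ∩ X) (indep-↓ M (p∩q⊆p B′ X) indB′ , p∩q⊆q B′ X)
  ... | A , basisA , B′∩X⊆A = ¬coindD (A , basisA , λ x∈D →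
      x∈p∧x∉q⇒x∈p─q (D⊆X x∈D) λ x∈A →
        G∌B′ (p⊆p∪q ((E M ─ X) ─ B) x∈D)
             (maxB′ (A ∪ (B ─ X)) (proj₁ (exchange basisA)) B′⊆ (p⊆p∪q (B ─ X) x∈A)))
    where
    G∌B′ : ∀ {x} → x ∈ G → x ∉ B′
    G∌B′ x∈G = x∈p─q⇒x∉q (E M) B′ (G⊆E─B′ x∈G)

    B′⊆ : B′ ⊆ A ∪ (B ─ X)
    B′⊆ {x} x∈B′ with x ∈? X
    ... | yes x∈X = p⊆p∪q (B ─ X) (B′∩X⊆A (x∈p∩q⁺ (x∈B′ , x∈X)))
    ... | no  x∉X = q⊆p∪q A (B ─ X) (x∈p∧x∉q⇒x∈p─q
      (decidable-stable (x ∈? B) λ x∉B → G∌B′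
        (q⊆p∪q D ((E M ─ X) ─ B)
          (x∈p∧x∉q⇒x∈p─q (x∈p∧x∉q⇒x∈p─q (indep⊆E M indB′ x∈B′) x∉X) x∉B))
        x∈B′)
      x∉X)

  -- Minimality does not refer to the ambient set, so a minimal set found inside `G` is a cocircuit
  -- of `M`.
  codependent : ∃ (MinimalDependent G (Coindep M))
  codependent = minimal-dependent (coindep? M) G (λ x∈G → x∈G) ¬coindG

  C : Subset _
  C = proj₁ codependent

  minimal : MinimalDependent G (Coindep M) C
  minimal = proj₂ codependent

  C⊆E : C ⊆ E M
  C⊆E x∈C = G⊆E (proj₁ minimal x∈C)

  ¬coindC : ¬ Coindep M C
  ¬coindC = proj₁ (proj₂ minimal)

  ¬coindD∩C : ¬ Coindep (restrict M X X⊆E) (D ∩ C)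
  ¬coindD∩C (A , basisA@((_ , A⊆X) , _) , D∩C⊆X─A) =
    ¬coindC (A ∪ (B ─ X) , exchange basisA , λ x∈C → x∈p∧x∉q⇒x∈p─q (C⊆E x∈C) (avoids x∈C))
    where
    avoids : ∀ {x} → x ∈ C → x ∉ A ∪ (B ─ X)
    avoids x∈C x∈ with x∈p∪q⁻ D ((E M ─ X) ─ B) (proj₁ minimal x∈C) | x∈p∪q⁻ A (B ─ X) x∈
    ... | inj₁ x∈D  | inj₁ x∈A   = x∈p─q⇒x∉q X A (D∩C⊆X─A (x∈p∩q⁺ (x∈D , x∈C))) x∈A
    ... | inj₁ x∈D  | inj₂ x∈B─X = x∈p─q⇒x∉q B X x∈B─X (D⊆X x∈D)
    ... | inj₂ x∈─B | inj₁ x∈A   = x∈p─q⇒x∉q (E M) X (p─q⊆p (E M ─ X) B x∈─B) (A⊆X x∈A)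
    ... | inj₂ x∈─B | inj₂ x∈B─X = x∈p─q⇒x∉q (E M ─ X) B x∈─B (p─q⊆p B X x∈B─X)

  D⊆C : D ⊆ C
  D⊆C {x} x∈D = decidable-stable (x ∈? C) λ x∉C →
    -- If `x` were missing from `C`, then `D ∩ C` would be a proper subset of `D`, hence
    -- coindependent.
    ¬coindD∩C (minD (D ∩ C) (p∩q⊆p D C , x , x∈D , λ x∈ → x∉C (p∩q⊆q D C x∈)))

-- Colourings

-- Colours outside `X` are arbitrary. Quantifying over all monochromatic subsets, not just full
-- colour classes, lets the hypothesis apply directly to sets such as `I ─ C`.
IndepColouring : Matroid n → ℕ → Subset n → Pred (Fin n → ℕ) 0ℓ
IndepColouring M k X f =
  (∀ {x} → x ∈ X → f x < k) ×
  (∀ {I i} → I ⊆ X → (∀ {x} → x ∈ I → f x ≡ i) → Indep M I)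

recolour : Subset n → (Fin n → ℕ) → Fin n → ℕ
recolour C f x with x ∈? C
... | yes _ = position C x
... | no  _ = f x

recolour-∈ : ∀ {C : Subset n} f {x} → x ∈ C → recolour C f x ≡ position C x
recolour-∈ {C = C} f {x} x∈C with x ∈? C
... | yes _   = refl
... | no  x∉C = contradiction x∈C x∉C

recolour-∉ : ∀ {C : Subset n} f {x} → x ∉ C → recolour C f x ≡ f x
recolour-∉ {C = C} f {x} x∉C with x ∈? C
... | yes x∈C = contradiction x∈C x∉C
... | no  _   = refl

-- A monochromatic `I` meets `C` in at most one element, since positions in `C` are distinct. The
-- rest of `I` is monochromatic for `f`, hence independent, and `cocircuit-augment` puts the missing
-- element back.
recolour-colouring :
  (M : Matroid n) → ∀ {X} (X⊆E : X ⊆ E M) {C f} → Cocircuit (restrict M X X⊆E) C → ∣ C ∣ ≤ k →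
  IndepColouring M k (X ─ C) f → IndepColouring M k X (recolour C f)
recolour-colouring {k = k} M {X} X⊆E {C} {f} cocircuit C≤k (f<k , f-indep) = bounded , indep
  where
  bounded : ∀ {x} → x ∈ X → recolour C f x < k
  bounded {x} x∈X with x ∈? C
  ... | yes x∈C = <-≤-trans (position<∣p∣ x∈C) C≤k
  ... | no  x∉C = f<k (x∈p∧x∉q⇒x∈p─q x∈X x∉C)

  indep : ∀ {I i} → I ⊆ X → (∀ {x} → x ∈ I → recolour C f x ≡ i) → Indep M I
  indep {I} {i} I⊆X mono with nonempty? (I ∩ C)
  ... | no  empty = f-indep
    (λ {x} x∈I → x∈p∧x∉q⇒x∈p─q (I⊆X x∈I) (I∌C x∈I))
    (λ x∈I → trans (sym (recolour-∉ f (I∌C x∈I))) (mono x∈I))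
    where
    I∌C : ∀ {x} → x ∈ I → x ∉ C
    I∌C {x} x∈I x∈C = empty (x , x∈p∩q⁺ (x∈I , x∈C))
  ... | yes (c , c∈I∩C) = indep-↓ M I⊆ (proj₁
      (cocircuit-augment (restrict M X X⊆E) cocircuit (indI─C , λ x∈ → I⊆X (p─q⊆p I C x∈))
        (λ (x , x∈) → let x∈I─C , x∈C = x∈p∩q⁻ (I ─ C) C x∈ in x∈p─q⇒x∉q I C x∈I─C x∈C)
        c∈C))
    where
    c∈I : c ∈ I
    c∈I = p∩q⊆p I C c∈I∩C

    c∈C : c ∈ C
    c∈C = p∩q⊆q I C c∈I∩C

    indI─C : Indep M (I ─ C)
    indI─C = f-indep
      (λ x∈ → x∈p∧x∉q⇒x∈p─q (I⊆X (p─q⊆p I C x∈)) (x∈p─q⇒x∉q I C x∈))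
      (λ x∈ → trans (sym (recolour-∉ f (x∈p─q⇒x∉q I C x∈))) (mono (p─q⊆p I C x∈)))

    I⊆ : I ⊆ (I ─ C) ∪ ⁅ c ⁆
    I⊆ {x} x∈I with x ∈? C
    ... | no  x∉C = p⊆p∪q ⁅ c ⁆ (x∈p∧x∉q⇒x∈p─q x∈I x∉C)
    ... | yes x∈C = q⊆p∪q (I ─ C) ⁅ c ⁆ (subst (_∈ ⁅ c ⁆) (sym x≡c) (x∈⁅x⁆ c))
      where
      x≡c : x ≡ c
      x≡c = position-injective x∈C c∈C
        (trans (sym (recolour-∈ f x∈C))
          (trans (trans (mono x∈I) (sym (mono c∈I))) (recolour-∈ f c∈C)))

degenerate⇒colouring : (M : Matroid n) → Degenerate M k → ∃ (IndepColouring M k (E M))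
degenerate⇒colouring {n} {k} M deg = go (E M) (⊂-wellFounded (E M)) (λ x∈E → x∈E)
  where
  go : ∀ X → Acc _⊂_ X → X ⊆ E M → ∃ (IndepColouring M k X)
  go X (acc rec) X⊆E with nonempty? X
  -- The colour 0 is a dummy: the bound is vacuous on an empty `X`, even for `k` equal to 0.
  ... | no  empty = const 0 , (λ {x} x∈X → contradiction (x , x∈X) empty) ,
    λ I⊆X _ → subst (Indep M) (sym (Empty-unique λ (x , x∈I) → empty (x , I⊆X x∈I))) (indep-⊥ M)
  ... | yes nonempty with deg X X⊆E nonempty
  ...   | C , cocircuit , C≤k =
    let c , c∈C = cocircuit-nonempty (restrict M X X⊆E) cocircuit
        -- Cocircuits are non-empty, so `X ─ C` is strictly smaller than `X`.
        f , colouring = go (X ─ C)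
          (rec (p∩q≢∅⇒p─q⊂p X C (c , x∈p∩q⁺ (proj₁ cocircuit c∈C , c∈C))))
          (λ x∈ → X⊆E (p─q⊆p X C x∈))
    in  recolour C f , recolour-colouring M X⊆E cocircuit C≤k colouring

colouring⇒partition : (M : Matroid n) → ∀ {f} → IndepColouring M k (E M) f →
                      ∃[ j ] (j ≤ k × PartitionableInto M j)
colouring⇒partition {n} {k} M {f} (f<k , f-indep) =
  length classes , length≤k , classes , refl , indeps , nonempties , disjoint , ⋃≡E
  where
  in-class? : ∀ i → Decidable (λ x → x ∈ E M × f x ≡ i)
  in-class? i x = (x ∈? E M) ×-dec (f x ≟ℕ i)

  class : ℕ → Subset n
  class i = ⟦ in-class? i ⟧

  classes : List (Subset n)
  classes = filter nonempty? (map class (upTo k))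

  all-classes : {P : Pred (Subset n) 0ℓ} → (∀ i → P (class i)) → All P classes
  all-classes Pclass = All.filter⁺ nonempty? (All.map⁺ (All.universal Pclass (upTo k)))

  length≤k : length classes ≤ k
  length≤k = ≤-trans (length-filter nonempty? (map class (upTo k)))
    (≤-reflexive (trans (length-map class (upTo k)) (length-upTo k)))

  indeps : All (Indep M) classes
  indeps = all-classes λ i → f-indep
    (λ x∈ → proj₁ (∈⟦⟧⁻ (in-class? i) x∈)) (λ x∈ → proj₂ (∈⟦⟧⁻ (in-class? i) x∈))

  nonempties : All Nonempty classes
  nonempties = All.all-filter nonempty? (map class (upTo k))

  ≢⇒disjoint : ∀ {i j} → i ≢ j → Disjoint (class i) (class j)
  ≢⇒disjoint {i} {j} i≢j (x , x∈) =
    let x∈i , x∈j = x∈p∩q⁻ (class i) (class j) x∈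
    in  i≢j (trans (sym (proj₂ (∈⟦⟧⁻ (in-class? i) x∈i))) (proj₂ (∈⟦⟧⁻ (in-class? j) x∈j)))

  disjoint : AllPairs Disjoint classes
  disjoint = AllPairs.filter⁺ nonempty? (AllPairs.map⁺ (AllPairs.map ≢⇒disjoint (Unique.upTo⁺ k)))

  ⋃≡E : ⋃ classes ≡ E M
  ⋃≡E = ⊆-antisym
    (⋃⊆ (all-classes λ i x∈ → proj₁ (∈⟦⟧⁻ (in-class? i) x∈)))
    (λ {x} x∈E → let x∈class = ∈⟦⟧⁺ (in-class? (f x)) (x∈E , refl) in
      ⊆⋃ (∈-filter⁺ nonempty? (∈-map⁺ class (∈-upTo⁺ (f<k x∈E))) (x , x∈class)) x∈class)

-- Bounds on arboricity and degeneracy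

arboricity≤degenerate : (M : Matroid n) (loopless : Loopless M) → Degenerate M k →
                        arboricity M loopless ≤ k
arboricity≤degenerate M loopless deg =
  let _ , colouring     = degenerate⇒colouring M deg
      j , j≤k , partition = colouring⇒partition M colouring
  in  ≤-trans (proj₂ (proj₂ (arboricity-exists M loopless)) j partition) j≤k

-- Looplessness provides a cocircuit of each non-empty restriction, and the cocircuit of `M`
-- containing it bounds its size.
c*-degenerate : (M : Matroid n) (loopless : Loopless M) (nonempty : Nonempty (E M)) →
                Degenerate M (c* M loopless nonempty)
c*-degenerate M loopless nonempty X X⊆E X-nonempty =
  let D , cocircuitD = cocircuit-exists (restrict M X X⊆E)
                         (restrict-loopless M loopless X X⊆E) X-nonempty
      C , cocircuitC , D⊆C = extend-restricted-cocircuit M X⊆E cocircuitD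
  in  D , cocircuitD , ≤-trans (p⊆q⇒∣p∣≤∣q∣ D⊆C)
        (proj₂ (proj₂ (c*-exists M loopless nonempty)) ∣ C ∣ (C , cocircuitC , refl))

proposition4p2 : ∀ {n} (M : Matroid n) (loopless : Loopless M) (nonempty : Nonempty (E M)) →
    arboricity M loopless ≤ degeneracy M loopless ×
    degeneracy M loopless ≤ c* M loopless nonempty
proposition4p2 M loopless nonempty =
    arboricity≤degenerate M loopless (proj₁ (proj₂ (degeneracy-exists M loopless)))
  , proj₂ (proj₂ (degeneracy-exists M loopless)) (c* M loopless nonempty)
      (c*-degenerate M loopless nonempty)
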